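{- Let $n\ge 2$ and $1\le k\le n-1$, and let $Q_{n,k}$ be the enhanced hypercube. Then the Kirchhoff index of $Q_{n,k}$ is \[Kf(Q_{n, k})=\begin{cases} 2^{n-1}\sum\limits_{t=0}^{n}\sum\limits_{j=0}^{n}\frac{1}{t+1}{n-k+2\choose 2j}{k-1\choose t+1-2j} &\text{if } n\equiv k \pmod 2,\\[2mm] 2^{n-1}\sum\limits_{t=0}^{n-1}\sum\limits_{j=0}^{n}\frac{1}{t+1}{n-k+2\choose 2j}{k-1\choose t+1-2j} &\text{if } n\not\equiv k \pmod 2. \end{cases}\]
   Context: For $n\ge 2$ and $1\le k\le n-1$, the enhanced hypercube $Q_{n,k}$ is the simple graph whose vertices are the binary strings $x_1x_2\cdots x_n$ ($x_i\in\{0,1\}$), where $X=x_1\cdots x_n$ and $Y$ are adjacent iff either $Y$ is obtained from $X$ by complementing exactly one coordinate $x_i$ ($1\le i\le n$), or $Y=x_1\cdots x_{k-1}\overline{x_k}\,\overline{x_{k+1}}\cdots\overline{x_n}$ (complementing all coordinates $k,\dots,n$). Equivalently, $Q_{n,k}$ is the Cayley graph $\mathrm{Cay}(\mathbb{Z}_2^n,S)$ with $S=\{e_1,\dots,e_n,\epsilon_k\}$, where $e_i$ are the standard basis vectors and $\epsilon_k=e_k+e_{k+1}+\cdots+e_n$. For a connected graph $\Gamma$, the resistance distance $r_{ij}$ between vertices $v_i,v_j$ is the effective resistance between them when every edge is a unit resistor, and the Kirchhoff index is $Kf(\Gamma)=\sum_{i<j} r_{ij}$. Binomial coefficients ${a\choose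 b}$ are taken to be $0$ when $b<0$ or $b>a$. -}

module Defs where

open import Data.Bool using (Bool; true; false; not; if_then_else_; _∧_; _∨_)
open import Data.Nat as ℕ using (ℕ; zero; suc; _≤ᵇ_; _∸_)
open import Data.Nat.Combinatorics using (_C_)
open import Data.Fin using (Fin; toℕ)
open import Data.Vec using (Vec; []; _∷_; lookup)
open import Data.List using (List; []; _∷_; _++_; map; concatMap)
open import Data.Product using (_×_; _,_; Σ; ∃)
open import Data.Integer using (+_)
open import Data.Rational using (ℚ; 0ℚ; 1ℚ; _+_; _-_; _*_; _/_)
open import Relation.Binary.PropositionalEquality using (_≡_)

-- Vertices of Q_{n,k}: binary strings x_1 ... x_n, as Vec Bool n
-- (coordinate x_i is at Fin index i-1).
V : ℕ → Set
V n = Vec Bool n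

allV : (n : ℕ) → List (V n)
allV zero = [] ∷ []
allV (suc n) = map (false ∷_) (allV n) ++ map (true ∷_) (allV n)

hamming : ∀ {n} → V n → V n → ℕ
hamming [] [] = 0
hamming (a ∷ xs) (b ∷ ys) = (if a Data.Bool.xor b then 1 else 0) ℕ.+ hamming xs ys
  where import Data.Bool

eqV : ∀ {n} → V n → V n → Bool
eqV xs ys = hamming xs ys ≤ᵇ 0

-- complement coordinates k,...,n (1-indexed), i.e. Fin indices i with toℕ i ≥ k-1
flipFrom : ∀ {n} → ℕ → V n → V n
flipFrom k xs = Data.Vec.tabulate (λ i → if (k ∸ 1) ≤ᵇ toℕ i then not (lookup xs i) else lookup xs i)
  where import Data.Vec

adj : (n k : ℕ) → V n → V n → Bool
adj n k x y = (hamming x y ℕ.≡ᵇ 1) ∨ eqV y (flipFrom k x)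

sumL : ∀ {A : Set} → List A → (A → ℚ) → ℚ
sumL [] f = 0ℚ
sumL (a ∷ as) f = f a + sumL as f

ind : Bool → ℚ
ind true = 1ℚ
ind false = 0ℚ

laplacian : (n k : ℕ) → (V n → ℚ) → V n → ℚ
laplacian n k x v = sumL (allV n) (λ u → ind (adj n k v u) * (x v - x u))

-- r is the resistance-distance function of Q_{n,k}: for each pair a,b there is
-- a potential x with unit current injected at a and extracted at b
-- (Kirchhoff's laws: L x = e_a - e_b, all edges unit resistors),
-- and r a b is the potential difference x a - x b.
IsResistance : (n k : ℕ) → (V n → V n → ℚ) → Set
IsResistance n k r =
  ∀ a b → Σ (V n → ℚ) λ x →
    (∀ v → laplacian n k x v ≡ ind (eqV v a) - ind (eqV v b)) × (r a b ≡ x a - x b)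

pairsLT : ∀ {A : Set} → List A → List (A × A)
pairsLT [] = []
pairsLT (a ∷ as) = map (a ,_) as ++ pairsLT as

Kf : (n : ℕ) → (V n → V n → ℚ) → ℚ
Kf n r = sumL (pairsLT (allV n)) (λ p → r (Data.Product.proj₁ p) (Data.Product.proj₂ p))
  where import Data.Product

sumTo : ℕ → (ℕ → ℚ) → ℚ
sumTo zero f = f 0
sumTo (suc m) f = sumTo m f + f (suc m)

natQ : ℕ → ℚ
natQ m = (+ m) / 1

binomDiff : ℕ → ℕ → ℕ → ℕ
binomDiff a m s = if s ≤ᵇ m then a C (m ∸ s) else 0

formula : (T n k : ℕ) → ℚ
formula T n k =
  natQ (2 ℕ.^ (n ∸ 1)) *
  sumTo T (λ t → sumTo n (λ j →
    ((+ 1) / suc t) * natQ ((n ∸ k ℕ.+ 2) C (2 ℕ.* j)) * natQ (binomDiff (k ∸ 1) (suc t) (2 ℕ.* j))))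

{-# OPTIONS --safe #-}
-- Q_{n,k} is a Cayley graph of ℤ₂ⁿ, so the characters χ_c diagonalise its Laplacian, with
-- eigenvalues 2 w(c), where w(c) is the weight of c plus the parity of c on the coordinates k,…,n.
-- Expanding a dipole in characters gives r(a,b) = ∑_{c≠0} (χ_c(a) - χ_c(b))² / (2ⁿ · 2 w(c)), and as
-- ∑_{a,b} (χ_c(a) - χ_c(b))² = 2 · 4ⁿ, summing over pairs yields Kf = 2ⁿ⁻¹ ∑_{c≠0} 1/w(c).
-- The last n-k+1 coordinates together with their parity bit form an even vector of length n-k+2
-- and w(c) is its weight plus that of the first k-1 coordinates; hence exactly
-- ∑_j C(n-k+2, 2j) C(k-1, t+1-2j) characters have w(c) = t+1.
module Submission where

open import Defs
open import Data.Nat using (ℕ; _≤_; _∸_; _%_)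
open import Data.Product using (_×_; Σ)
open import Data.Rational using (ℚ)
open import Relation.Binary.PropositionalEquality using (_≡_)
open import Relation.Nullary using (¬_)

open import Data.Bool using (Bool; true; false; not; _∧_; _∨_; _xor_; if_then_else_)
open import Data.Integer as ℤ using () renaming (+_ to pos)
import Data.Integer.Properties as ℤₚ
open import Data.List using (List; []; _∷_; _++_; map)
open import Data.Nat as ℕ using (zero; suc; _≤ᵇ_; _≡ᵇ_; z≤n; s≤s; _<_)
open import Data.Nat.Combinatorics using (_C_; k>n⇒nCk≡0; nCn≡1; nCk≡nC[n∸k]; nCk+nC[k+1]≡[n+1]C[k+1])
open import Data.Nat.DivMod using ([m+kn]%n≡m%n)
import Data.Nat.Properties as ℕₚ
open import Data.Product using (_,_; proj₁; proj₂)
open import Data.Rational using (0ℚ; 1ℚ; ½; _+_; _-_; _*_; -_; _/_; toℚᵘ)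
open import Data.Rational.Properties
  using (+-identityˡ; +-identityʳ; *-identityˡ; *-zeroˡ; *-zeroʳ; *-comm; *-assoc;
         +-assoc; +-comm; *-distribˡ-+; *-distribʳ-+; toℚᵘ-injective; toℚᵘ-fromℚᵘ; toℚᵘ-homo-+; toℚᵘ-homo-*)
open import Data.Rational.Solver using (module +-*-Solver)
open import Data.Rational.Unnormalised as ℚᵘ using (mkℚᵘ; *≡*; _≃_)
import Data.Rational.Unnormalised.Properties as ℚᵘₚ
open import Data.Vec using ([]; _∷_)
open import Function using (_∘_)
open import Relation.Binary.PropositionalEquality
  using (_≢_; refl; sym; trans; cong; cong₂; subst; module ≡-Reasoning)
open import Relation.Binary.Definitions using (tri<; tri≈; tri>)
open import Relation.Nullary using (contradiction; yes; no)

open ≡-Reasoning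
open +-*-Solver using (solve; _:=_; _:+_; _:*_; _:-_; :-_; con)

-- Naturals and their reciprocals as rational numbers

natQ-toℚᵘ : ∀ m → toℚᵘ (natQ m) ≃ mkℚᵘ (pos m) 0
natQ-toℚᵘ m = toℚᵘ-fromℚᵘ (mkℚᵘ (pos m) 0)

-- `_/_` normalises by a gcd and is stuck on open terms, so the identity is checked on unnormalised
-- fractions, where it is integer arithmetic.
natQ-+ : ∀ a b → natQ (a ℕ.+ b) ≡ natQ a + natQ b
natQ-+ a b = toℚᵘ-injective (begin-≃
  toℚᵘ (natQ (a ℕ.+ b))                 ≈⟨ natQ-toℚᵘ (a ℕ.+ b) ⟩
  mkℚᵘ (pos (a ℕ.+ b)) 0                  ≈⟨ *≡* (cong (λ z → z ℤ.* pos 1) (sym (cong₂ ℤ._+_ (ℤₚ.*-identityʳ (pos a)) (ℤₚ.*-identityʳ (pos b))))) ⟩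
  mkℚᵘ (pos a) 0 ℚᵘ.+ mkℚᵘ (pos b) 0        ≈⟨ ℚᵘₚ.+-cong (natQ-toℚᵘ a) (natQ-toℚᵘ b) ⟨
  toℚᵘ (natQ a) ℚᵘ.+ toℚᵘ (natQ b)      ≈⟨ toℚᵘ-homo-+ (natQ a) (natQ b) ⟨
  toℚᵘ (natQ a + natQ b)                ∎≃)
  where
  open ℚᵘₚ.≃-Reasoning renaming (begin_ to begin-≃_; _∎ to _∎≃)

natQ-* : ∀ a b → natQ (a ℕ.* b) ≡ natQ a * natQ b
natQ-* zero b = sym (*-zeroˡ (natQ b))
natQ-* (suc a) b = begin
  natQ (b ℕ.+ a ℕ.* b)          ≡⟨ natQ-+ b (a ℕ.* b) ⟩
  natQ b + natQ (a ℕ.* b)       ≡⟨ cong (natQ b +_) (natQ-* a b) ⟩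
  natQ b + natQ a * natQ b      ≡⟨ solve 2 (λ x y → y :+ x :* y := (con 1ℚ :+ x) :* y) refl (natQ a) (natQ b) ⟩
  (1ℚ + natQ a) * natQ b        ≡⟨ cong (_* natQ b) (natQ-+ 1 a) ⟨
  natQ (suc a) * natQ b         ∎

-- The value 0 at 0 makes inverting eigenvalues a pseudo-inverse, so that spectral sums can run over
-- all characters.
recip : ℕ → ℚ
recip zero = 0ℚ
recip (suc t) = (pos 1) / suc t

recip-natQ : ∀ m → m ≢ 0 → recip m * natQ m ≡ 1ℚ
recip-natQ zero m≢0 = contradiction refl m≢0
recip-natQ (suc t) _ = toℚᵘ-injective (begin-≃
  toℚᵘ (recip (suc t) * natQ (suc t))                ≈⟨ toℚᵘ-homo-* (recip (suc t)) (natQ (suc t)) ⟩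
  toℚᵘ (recip (suc t)) ℚᵘ.* toℚᵘ (natQ (suc t))      ≈⟨ ℚᵘₚ.*-cong (toℚᵘ-fromℚᵘ (mkℚᵘ (pos 1) t)) (natQ-toℚᵘ (suc t)) ⟩
  mkℚᵘ (pos 1) t ℚᵘ.* mkℚᵘ (pos (suc t)) 0                 ≈⟨ *≡* (trans (ℤₚ.*-identityʳ _) (cong (pos 1 ℤ.*_) (sym (ℤₚ.*-identityʳ (pos (suc t)))))) ⟩
  toℚᵘ 1ℚ                                            ∎≃)
  where
  open ℚᵘₚ.≃-Reasoning renaming (begin_ to begin-≃_; _∎ to _∎≃)

-- Finite sums

sumL-cong : ∀ {A : Set} (L : List A) {f g : A → ℚ} → (∀ a → f a ≡ g a) → sumL L f ≡ sumL L g
sumL-cong [] e = refl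
sumL-cong (a ∷ L) e = cong₂ _+_ (e a) (sumL-cong L e)

sumL-zero : ∀ {A : Set} (L : List A) → sumL L (λ _ → 0ℚ) ≡ 0ℚ
sumL-zero [] = refl
sumL-zero (a ∷ L) = trans (+-identityˡ _) (sumL-zero L)

sumL-+ : ∀ {A : Set} (L : List A) (f g : A → ℚ) →
  sumL L (λ a → f a + g a) ≡ sumL L f + sumL L g
sumL-+ [] f g = refl
sumL-+ (a ∷ L) f g = trans (cong ((f a + g a) +_) (sumL-+ L f g))
  (solve 4 (λ x y s t → x :+ y :+ (s :+ t) := x :+ s :+ (y :+ t)) refl (f a) (g a) (sumL L f) (sumL L g))

sumL-*ˡ : ∀ {A : Set} (L : List A) (q : ℚ) (f : A → ℚ) →
  sumL L (λ a → q * f a) ≡ q * sumL L f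
sumL-*ˡ [] q f = sym (*-zeroʳ q)
sumL-*ˡ (a ∷ L) q f = trans (cong ((q * f a) +_) (sumL-*ˡ L q f)) (sym (*-distribˡ-+ q (f a) (sumL L f)))

sumL-- : ∀ {A : Set} (L : List A) (f g : A → ℚ) →
  sumL L (λ a → f a - g a) ≡ sumL L f - sumL L g
sumL-- [] f g = refl
sumL-- (a ∷ L) f g = trans (cong ((f a - g a) +_) (sumL-- L f g))
  (solve 4 (λ x y s t → x :- y :+ (s :- t) := x :+ s :- (y :+ t)) refl (f a) (g a) (sumL L f) (sumL L g))

sumL-swap : ∀ {A B : Set} (L : List A) (M : List B) (f : A → B → ℚ) →
  sumL L (λ a → sumL M (f a)) ≡ sumL M (λ b → sumL L (λ a → f a b))
sumL-swap [] M f = sym (sumL-zero M)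
sumL-swap (a ∷ L) M f = trans (cong ((sumL M (f a)) +_) (sumL-swap L M f))
  (sym (sumL-+ M (f a) (λ b → sumL L (λ a → f a b))))

sumL-++ : ∀ {A : Set} (L M : List A) (f : A → ℚ) → sumL (L ++ M) f ≡ sumL L f + sumL M f
sumL-++ [] M f = sym (+-identityˡ _)
sumL-++ (a ∷ L) M f = trans (cong ((f a) +_) (sumL-++ L M f)) (sym (+-assoc (f a) (sumL L f) (sumL M f)))

sumL-map : ∀ {A B : Set} (h : A → B) (L : List A) (f : B → ℚ) → sumL (map h L) f ≡ sumL L (f ∘ h)
sumL-map h [] f = refl
sumL-map h (a ∷ L) f = cong ((f (h a)) +_) (sumL-map h L f)

sumV : ∀ n → (V n → ℚ) → ℚ
sumV n = sumL (allV n)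

sumV-suc : ∀ n (f : V (suc n) → ℚ) → sumV (suc n) f ≡ sumV n (f ∘ (false ∷_)) + sumV n (f ∘ (true ∷_))
sumV-suc n f = trans (sumL-++ (map (false ∷_) (allV n)) _ f)
  (cong₂ _+_ (sumL-map (false ∷_) (allV n) f) (sumL-map (true ∷_) (allV n) f))

sumV-one : ∀ n → sumV n (λ _ → 1ℚ) ≡ natQ (2 ℕ.^ n)
sumV-one zero = refl
sumV-one (suc n) = begin
  sumV (suc n) (λ _ → 1ℚ)                           ≡⟨ sumV-suc n (λ _ → 1ℚ) ⟩
  sumV n (λ _ → 1ℚ) + sumV n (λ _ → 1ℚ)             ≡⟨ cong₂ _+_ (sumV-one n) (sumV-one n) ⟩
  natQ (2 ℕ.^ n) + natQ (2 ℕ.^ n)                   ≡⟨ solve 1 (λ x → x :+ x := con (natQ 2) :* x) refl (natQ (2 ℕ.^ n)) ⟩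
  natQ 2 * natQ (2 ℕ.^ n)                           ≡⟨ natQ-* 2 (2 ℕ.^ n) ⟨
  natQ (2 ℕ.^ suc n)                                ∎

-- Each unordered pair occurs twice among the ordered ones, and the diagonal contributes nothing.
-- The induction peels off the row and the column of the head, whose sums agree by symmetry.
sumL-pairsLT : ∀ {A : Set} (L : List A) (f : A → A → ℚ) → (∀ a b → f a b ≡ f b a) → (∀ a → f a a ≡ 0ℚ) →
  sumL L (λ a → sumL L (f a)) ≡ natQ 2 * sumL (pairsLT L) (λ p → f (proj₁ p) (proj₂ p))
sumL-pairsLT [] f f-sym f-diag = refl
sumL-pairsLT (a ∷ L) f f-sym f-diag = begin
  f a a + row + sumL L (λ b → f b a + sumL L (f b))
    ≡⟨ cong₂ (λ x y → x + row + y) (f-diag a) (sumL-+ L (λ b → f b a) (λ b → sumL L (f b))) ⟩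
  0ℚ + row + (sumL L (λ b → f b a) + sumL L (λ b → sumL L (f b)))
    ≡⟨ cong₂ (λ x y → 0ℚ + row + (x + y)) (sumL-cong L (λ b → f-sym b a)) (sumL-pairsLT L f f-sym f-diag) ⟩
  0ℚ + row + (row + natQ 2 * rest)
    ≡⟨ solve 2 (λ x y → con 0ℚ :+ x :+ (x :+ con (natQ 2) :* y) := con (natQ 2) :* (x :+ y)) refl row rest ⟩
  natQ 2 * (row + rest)
    ≡⟨ cong (λ x → natQ 2 * (x + rest)) (sumL-map (a ,_) L (λ p → f (proj₁ p) (proj₂ p))) ⟨
  natQ 2 * (sumL (map (a ,_) L) _ + rest)
    ≡⟨ cong (natQ 2 *_) (sumL-++ (map (a ,_) L) (pairsLT L) _) ⟨
  natQ 2 * sumL (pairsLT (a ∷ L)) (λ p → f (proj₁ p) (proj₂ p)) ∎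
  where
  row  = sumL L (f a)
  rest = sumL (pairsLT L) (λ p → f (proj₁ p) (proj₂ p))

-- The Laplacian

hamming-sym : ∀ {n} (v u : V n) → hamming v u ≡ hamming u v
hamming-sym [] [] = refl
hamming-sym (false ∷ v) (false ∷ u) = hamming-sym v u
hamming-sym (false ∷ v) (true  ∷ u) = cong suc (hamming-sym v u)
hamming-sym (true  ∷ v) (false ∷ u) = cong suc (hamming-sym v u)
hamming-sym (true  ∷ v) (true  ∷ u) = hamming-sym v u

eqV-sound : ∀ {n} (v u : V n) → eqV v u ≡ true → v ≡ u
eqV-sound [] [] e = refl
eqV-sound (false ∷ v) (false ∷ u) e = cong (false ∷_) (eqV-sound v u e)
eqV-sound (true  ∷ v) (true  ∷ u) e = cong (true ∷_) (eqV-sound v u e)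

sumL-0* : ∀ {A : Set} (L : List A) (f : A → ℚ) → sumL L (λ a → 0ℚ * f a) ≡ 0ℚ
sumL-0* L f = trans (sumL-*ˡ L 0ℚ f) (*-zeroˡ (sumL L f))

sumV-eqV : ∀ n (w : V n) (f : V n → ℚ) → sumV n (λ u → ind (eqV u w) * f u) ≡ f w
sumV-eqV zero [] f = trans (+-identityʳ _) (*-identityˡ (f []))
sumV-eqV (suc n) (false ∷ w) f = begin
  sumV (suc n) (λ u → ind (eqV u (false ∷ w)) * f u)
    ≡⟨ sumV-suc n _ ⟩
  sumV n (λ u → ind (eqV u w) * f (false ∷ u)) + sumV n (λ u → 0ℚ * f (true ∷ u))
    ≡⟨ cong₂ _+_ (sumV-eqV n w (f ∘ (false ∷_))) (sumL-0* (allV n) (f ∘ (true ∷_))) ⟩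
  f (false ∷ w) + 0ℚ
    ≡⟨ +-identityʳ _ ⟩
  f (false ∷ w) ∎
sumV-eqV (suc n) (true ∷ w) f = begin
  sumV (suc n) (λ u → ind (eqV u (true ∷ w)) * f u)
    ≡⟨ sumV-suc n _ ⟩
  sumV n (λ u → 0ℚ * f (false ∷ u)) + sumV n (λ u → ind (eqV u w) * f (true ∷ u))
    ≡⟨ cong₂ _+_ (sumL-0* (allV n) (f ∘ (false ∷_))) (sumV-eqV n w (f ∘ (true ∷_))) ⟩
  0ℚ + f (true ∷ w)
    ≡⟨ +-identityˡ _ ⟩
  f (true ∷ w) ∎

-- The split on `j` lets `_≤ᵇ_` reduce: on a successor it computes through `_<ᵇ_`, which needs the
-- shape of `j` to proceed.
flipFrom-suc : ∀ {n} j b (v : V n) → flipFrom (suc (suc j)) (b ∷ v) ≡ b ∷ flipFrom (suc j) v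
flipFrom-suc zero b v = refl
flipFrom-suc (suc j) b v = refl

-- All coordinates after the first `j` are flipped. This distance separates the extra edge from the
-- coordinate edges in `ind-adj`.
hamming-flipFrom-self : ∀ {n} j (v : V n) → hamming v (flipFrom (suc j) v) ≡ n ∸ j
hamming-flipFrom-self j [] = sym (ℕₚ.0∸n≡0 j)
hamming-flipFrom-self zero (false ∷ v) = cong suc (hamming-flipFrom-self zero v)
hamming-flipFrom-self zero (true  ∷ v) = cong suc (hamming-flipFrom-self zero v)
hamming-flipFrom-self (suc j) (false ∷ v) = trans (cong (hamming (false ∷ v)) (flipFrom-suc j false v)) (hamming-flipFrom-self j v)
hamming-flipFrom-self (suc j) (true  ∷ v) = trans (cong (hamming (true ∷ v)) (flipFrom-suc j true v)) (hamming-flipFrom-self j v)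

-- Translation by a fixed vector is an isometry and its own inverse, so it can be moved to the other
-- argument. Hence the extra edges are undirected.
hamming-flipFrom-sym : ∀ {n} j (u v : V n) → hamming u (flipFrom (suc j) v) ≡ hamming v (flipFrom (suc j) u)
hamming-flipFrom-sym j [] [] = refl
hamming-flipFrom-sym zero (false ∷ u) (false ∷ v) = cong suc (hamming-flipFrom-sym zero u v)
hamming-flipFrom-sym zero (false ∷ u) (true  ∷ v) = hamming-flipFrom-sym zero u v
hamming-flipFrom-sym zero (true  ∷ u) (false ∷ v) = hamming-flipFrom-sym zero u v
hamming-flipFrom-sym zero (true  ∷ u) (true  ∷ v) = cong suc (hamming-flipFrom-sym zero u v)
hamming-flipFrom-sym (suc j) (a ∷ u) (b ∷ v) = trans (cong (hamming (a ∷ u)) (flipFrom-suc j b v))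
  (trans (step a b) (cong (hamming (b ∷ v)) (sym (flipFrom-suc j a u))))
  where
  step : ∀ a b → hamming (a ∷ u) (b ∷ flipFrom (suc j) v) ≡ hamming (b ∷ v) (a ∷ flipFrom (suc j) u)
  step false false = hamming-flipFrom-sym j u v
  step false true  = cong suc (hamming-flipFrom-sym j u v)
  step true  false = cong suc (hamming-flipFrom-sym j u v)
  step true  true  = hamming-flipFrom-sym j u v

adj-sym : ∀ n j (u v : V n) → adj n (suc j) u v ≡ adj n (suc j) v u
adj-sym n j u v = cong₂ (λ x y → (x ≡ᵇ 1) ∨ (y ≤ᵇ 0)) (hamming-sym u v) (hamming-flipFrom-sym j v u)

-- The disjunction in `adj` becomes a sum because its alternatives exclude each other: the extra
-- edge leads to Hamming distance `n ∸ j`, which is at least 2.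
ind-adj : ∀ n j → 2 ≤ n ∸ j → (v u : V n) →
  ind (adj n (suc j) v u) ≡ ind (hamming v u ≡ᵇ 1) + ind (eqV u (flipFrom (suc j) v))
ind-adj n j 2≤m v u with eqV u (flipFrom (suc j) v) in eq
... | false = trans (cong ind (∨-identityʳ (hamming v u ≡ᵇ 1))) (sym (+-identityʳ (ind (hamming v u ≡ᵇ 1))))
  where open import Data.Bool.Properties using (∨-identityʳ)
... | true rewrite eqV-sound u _ eq | hamming-flipFrom-self j v with n ∸ j | 2≤m
...   | suc (suc m) | _ = refl
...   | suc zero | s≤s ()

-- Splits ⟨y, Lx⟩ into a degree part and an adjacency part, so that the symmetry of each can be
-- checked separately.
laplacian-dirichlet : ∀ n k (x y : V n → ℚ) →
  sumV n (λ v → y v * laplacian n k x v) ≡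
  sumV n (λ v → sumV n λ u → ind (adj n k v u) * (y v * x v)) - sumV n (λ v → sumV n λ u → ind (adj n k v u) * (y v * x u))
laplacian-dirichlet n k x y = trans (sumL-cong (allV n) row) (sumL-- (allV n) _ _)
  where
  row : ∀ v → y v * laplacian n k x v ≡
    sumV n (λ u → ind (adj n k v u) * (y v * x v)) - sumV n (λ u → ind (adj n k v u) * (y v * x u))
  row v = begin
    y v * laplacian n k x v
      ≡⟨ sumL-*ˡ (allV n) (y v) _ ⟨
    sumV n (λ u → y v * (ind (adj n k v u) * (x v - x u)))
      ≡⟨ sumL-cong (allV n) (λ u → solve 4 (λ p q s t → p :* (q :* (s :- t)) := q :* (p :* s) :- q :* (p :* t)) refl (y v) (ind (adj n k v u)) (x v) (x u)) ⟩
    sumV n (λ u → ind (adj n k v u) * (y v * x v) - ind (adj n k v u) * (y v * x u))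
      ≡⟨ sumL-- (allV n) _ _ ⟩
    sumV n (λ u → ind (adj n k v u) * (y v * x v)) - sumV n (λ u → ind (adj n k v u) * (y v * x u)) ∎

laplacian-selfAdjoint : ∀ n j (x y : V n → ℚ) →
  sumV n (λ v → y v * laplacian n (suc j) x v) ≡ sumV n (λ v → x v * laplacian n (suc j) y v)
laplacian-selfAdjoint n j x y = begin
  sumV n (λ v → y v * laplacian n (suc j) x v)
    ≡⟨ laplacian-dirichlet n (suc j) x y ⟩
  sumV n (λ v → sumV n λ u → A v u * (y v * x v)) - sumV n (λ v → sumV n λ u → A v u * (y v * x u))
    ≡⟨ cong₂ _-_
         (sumL-cong (allV n) λ v → sumL-cong (allV n) λ u → cong (A v u *_) (*-comm (y v) (x v)))
         -- In the adjacency part `v` and `u` exchange roles, which is harmless as adjacency is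
         -- symmetric.
         (trans (sumL-swap (allV n) (allV n) _)
           (sumL-cong (allV n) λ v → sumL-cong (allV n) λ u → cong₂ _*_ (cong ind (adj-sym n j u v)) (*-comm (y u) (x v)))) ⟩
  sumV n (λ v → sumV n λ u → A v u * (x v * y v)) - sumV n (λ v → sumV n λ u → A v u * (x v * y u))
    ≡⟨ laplacian-dirichlet n (suc j) y x ⟨
  sumV n (λ v → x v * laplacian n (suc j) y v) ∎
  where
  A : V n → V n → ℚ
  A v u = ind (adj n (suc j) v u)

sumV-dipole : ∀ n (x : V n → ℚ) a b → sumV n (λ v → x v * (ind (eqV v a) - ind (eqV v b))) ≡ x a - x b
sumV-dipole n x a b = begin
  sumV n (λ v → x v * (ind (eqV v a) - ind (eqV v b)))
    ≡⟨ sumL-cong (allV n) (λ v → solve 3 (λ p s t → p :* (s :- t) := s :* p :- t :* p) refl (x v) (ind (eqV v a)) (ind (eqV v b))) ⟩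
  sumV n (λ v → ind (eqV v a) * x v - ind (eqV v b) * x v)
    ≡⟨ sumL-- (allV n) _ _ ⟩
  sumV n (λ v → ind (eqV v a) * x v) - sumV n (λ v → ind (eqV v b) * x v)
    ≡⟨ cong₂ _-_ (sumV-eqV n a x) (sumV-eqV n b x) ⟩
  x a - x b ∎

-- The drop across a, b is ⟨x, Ly⟩ = ⟨Lx, y⟩, so it does not depend on the chosen potential.
potential-drop-unique : ∀ n j (x y : V n → ℚ) a b →
  (∀ v → laplacian n (suc j) x v ≡ ind (eqV v a) - ind (eqV v b)) →
  (∀ v → laplacian n (suc j) y v ≡ ind (eqV v a) - ind (eqV v b)) →
  x a - x b ≡ y a - y b
potential-drop-unique n j x y a b Lx Ly = begin
  x a - x b                                              ≡⟨ sumV-dipole n x a b ⟨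
  sumV n (λ v → x v * (ind (eqV v a) - ind (eqV v b)))   ≡⟨ sumL-cong (allV n) (λ v → cong (x v *_) (Ly v)) ⟨
  sumV n (λ v → x v * laplacian n (suc j) y v)           ≡⟨ laplacian-selfAdjoint n j x y ⟨
  sumV n (λ v → y v * laplacian n (suc j) x v)           ≡⟨ sumL-cong (allV n) (λ v → cong (y v *_) (Lx v)) ⟩
  sumV n (λ v → y v * (ind (eqV v a) - ind (eqV v b)))   ≡⟨ sumV-dipole n y a b ⟩
  y a - y b                                              ∎

-- Characters of ℤ₂ⁿ

sgn : Bool → ℚ
sgn false = 1ℚ
sgn true  = - 1ℚ

-- The character v ↦ (-1)^(c·v).
χ : ∀ {n} → V n → V n → ℚ
χ [] [] = 1ℚ
χ (c ∷ cs) (v ∷ vs) = sgn (c ∧ v) * χ cs vs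

bit : Bool → ℕ
bit false = 0
bit true  = 1

weight : ∀ {n} → V n → ℕ
weight [] = 0
weight (c ∷ cs) = bit c ℕ.+ weight cs

-- Here `j` is k-1, the number of coordinates skipped. The result is the inner product of c with the
-- generator ε_k, so its sign is the value of the character at ε_k.
tailParity : ∀ {n} → ℕ → V n → Bool
tailParity j [] = false
tailParity zero (c ∷ cs) = c xor tailParity zero cs
tailParity (suc j) (c ∷ cs) = tailParity j cs

-- Half the eigenvalue of χ c on Q_{n,j+1}.
w : ∀ {n} → ℕ → V n → ℕ
w j c = weight c ℕ.+ bit (tailParity j c)

χ-zero : ∀ {n} (c : V n) → weight c ≡ 0 → ∀ v → χ c v ≡ 1ℚ
χ-zero [] e [] = refl
χ-zero (false ∷ c) e (v ∷ vs) = trans (*-identityˡ _) (χ-zero c e vs)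

tailParity-zero : ∀ {n} j (c : V n) → weight c ≡ 0 → tailParity j c ≡ false
tailParity-zero j [] e = refl
tailParity-zero zero (false ∷ c) e = tailParity-zero zero c e
tailParity-zero (suc j) (false ∷ c) e = tailParity-zero j c e

-- At a coordinate where `c` has a 1 the two halves of the cube cancel; nonzero weight guarantees
-- such a coordinate.
sumV-χ : ∀ n (c : V n) → weight c ≢ 0 → sumV n (χ c) ≡ 0ℚ
sumV-χ zero [] c≢0 = contradiction refl c≢0
sumV-χ (suc n) (false ∷ c) c≢0 = trans (sumV-suc n (χ (false ∷ c))) (cong₂ _+_ half half)
  where
  half : sumV n (λ v → 1ℚ * χ c v) ≡ 0ℚ
  half = trans (sumL-cong (allV n) (λ v → *-identityˡ (χ c v))) (sumV-χ n c c≢0)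
sumV-χ (suc n) (true ∷ c) _ = begin
  sumV (suc n) (χ (true ∷ c))
    ≡⟨ sumV-suc n (χ (true ∷ c)) ⟩
  sumV n (λ v → 1ℚ * χ c v) + sumV n (λ v → - 1ℚ * χ c v)
    ≡⟨ cong₂ _+_ (sumL-*ˡ (allV n) 1ℚ (χ c)) (sumL-*ˡ (allV n) (- 1ℚ) (χ c)) ⟩
  1ℚ * sumV n (χ c) + - 1ℚ * sumV n (χ c)
    ≡⟨ solve 1 (λ s → con 1ℚ :* s :+ :- con 1ℚ :* s := con 0ℚ) refl (sumV n (χ c)) ⟩
  0ℚ ∎

χ-square : ∀ {n} (c v : V n) → χ c v * χ c v ≡ 1ℚ
χ-square [] [] = refl
χ-square (c ∷ cs) (v ∷ vs) = begin
  sgn (c ∧ v) * χ cs vs * (sgn (c ∧ v) * χ cs vs)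
    ≡⟨ solve 2 (λ s x → s :* x :* (s :* x) := s :* s :* (x :* x)) refl (sgn (c ∧ v)) (χ cs vs) ⟩
  sgn (c ∧ v) * sgn (c ∧ v) * (χ cs vs * χ cs vs)
    ≡⟨ cong₂ _*_ (sgn-square (c ∧ v)) (χ-square cs vs) ⟩
  1ℚ ∎
  where
  sgn-square : ∀ b → sgn b * sgn b ≡ 1ℚ
  sgn-square false = refl
  sgn-square true = refl

-- The sum is over the characters, not the vertices, since it serves to expand point masses in
-- characters. A new coordinate multiplies it by 1 + `sgn a * sgn b`, which is 2 or 0.
χ-orthogonal : ∀ n (v u : V n) → sumV n (λ c → χ c v * χ c u) ≡ natQ (2 ℕ.^ n) * ind (eqV v u)
χ-orthogonal zero [] [] = refl
χ-orthogonal (suc n) (a ∷ v) (b ∷ u) = begin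
  sumV (suc n) (λ c → χ c (a ∷ v) * χ c (b ∷ u))
    ≡⟨ sumV-suc n _ ⟩
  sumV n (λ c → 1ℚ * χ c v * (1ℚ * χ c u)) + sumV n (λ c → sgn a * χ c v * (sgn b * χ c u))
    ≡⟨ cong₂ _+_ (sumL-cong (allV n) (λ c → regroup 1ℚ 1ℚ (χ c v) (χ c u))) (sumL-cong (allV n) (λ c → regroup (sgn a) (sgn b) (χ c v) (χ c u))) ⟩
  sumV n (λ c → 1ℚ * 1ℚ * (χ c v * χ c u)) + sumV n (λ c → sgn a * sgn b * (χ c v * χ c u))
    ≡⟨ cong₂ _+_ (sumL-*ˡ (allV n) (1ℚ * 1ℚ) _) (sumL-*ˡ (allV n) (sgn a * sgn b) _) ⟩
  1ℚ * 1ℚ * sumV n (λ c → χ c v * χ c u) + sgn a * sgn b * sumV n (λ c → χ c v * χ c u)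
    ≡⟨ cong (λ s → 1ℚ * 1ℚ * s + sgn a * sgn b * s) (χ-orthogonal n v u) ⟩
  1ℚ * 1ℚ * (N * ind (eqV v u)) + sgn a * sgn b * (N * ind (eqV v u))
    ≡⟨ cases a b ⟩
  natQ 2 * N * ind (eqV (a ∷ v) (b ∷ u))
    ≡⟨ cong (_* ind (eqV (a ∷ v) (b ∷ u))) (natQ-* 2 (2 ℕ.^ n)) ⟨
  natQ (2 ℕ.^ suc n) * ind (eqV (a ∷ v) (b ∷ u)) ∎
  where
  N = natQ (2 ℕ.^ n)
  regroup : ∀ s t x y → s * x * (t * y) ≡ s * t * (x * y)
  regroup = solve 4 (λ s t x y → s :* x :* (t :* y) := s :* t :* (x :* y)) refl
  same : ∀ x y → 1ℚ * 1ℚ * (x * y) + 1ℚ * 1ℚ * (x * y) ≡ natQ 2 * x * y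
  same = solve 2 (λ x y → con 1ℚ :* (x :* y) :+ con 1ℚ :* (x :* y) := con (natQ 2) :* x :* y) refl
  differ : ∀ x y → 1ℚ * 1ℚ * (x * y) + - 1ℚ * (x * y) ≡ natQ 2 * x * 0ℚ
  differ = solve 2 (λ x y → con 1ℚ :* (x :* y) :+ (:- con 1ℚ) :* (x :* y) := con (natQ 2) :* x :* con 0ℚ) refl
  cases : ∀ a b → 1ℚ * 1ℚ * (N * ind (eqV v u)) + sgn a * sgn b * (N * ind (eqV v u)) ≡ natQ 2 * N * ind (eqV (a ∷ v) (b ∷ u))
  cases false false = same N (ind (eqV v u))
  cases false true  = differ N (ind (eqV v u))
  cases true  false = differ N (ind (eqV v u))
  cases true  true  = same N (ind (eqV v u))

-- `flipFrom` translates by ε_k, and a character turns the translation into multiplication by its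
-- value at ε_k.
χ-flipFrom : ∀ {n} j (c v : V n) → χ c (flipFrom (suc j) v) ≡ sgn (tailParity j c) * χ c v
χ-flipFrom j [] [] = refl
χ-flipFrom zero (c ∷ cs) (v ∷ vs) = begin
  sgn (c ∧ not v) * χ cs (flipFrom 1 vs)                 ≡⟨ cong (sgn (c ∧ not v) *_) (χ-flipFrom zero cs vs) ⟩
  sgn (c ∧ not v) * (sgn p * χ cs vs)                    ≡⟨ *-assoc (sgn (c ∧ not v)) (sgn p) (χ cs vs) ⟨
  sgn (c ∧ not v) * sgn p * χ cs vs                      ≡⟨ cong (_* χ cs vs) (signs c v p) ⟩
  sgn (c xor p) * sgn (c ∧ v) * χ cs vs                  ≡⟨ *-assoc (sgn (c xor p)) (sgn (c ∧ v)) (χ cs vs) ⟩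
  sgn (c xor p) * (sgn (c ∧ v) * χ cs vs)                ∎
  where
  p = tailParity zero cs
  signs : ∀ c v p → sgn (c ∧ not v) * sgn p ≡ sgn (c xor p) * sgn (c ∧ v)
  signs false v false = refl
  signs false v true = refl
  signs true false false = refl
  signs true false true = refl
  signs true true false = refl
  signs true true true = refl
χ-flipFrom (suc j) (c ∷ cs) (v ∷ vs) = begin
  χ (c ∷ cs) (flipFrom (suc (suc j)) (v ∷ vs))           ≡⟨ cong (χ (c ∷ cs)) (flipFrom-suc j v vs) ⟩
  sgn (c ∧ v) * χ cs (flipFrom (suc j) vs)               ≡⟨ cong (sgn (c ∧ v) *_) (χ-flipFrom j cs vs) ⟩
  sgn (c ∧ v) * (sgn p * χ cs vs)                        ≡⟨ solve 3 (λ s t x → s :* (t :* x) := t :* (s :* x)) refl (sgn (c ∧ v)) (sgn p) (χ cs vs) ⟩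
  sgn p * (sgn (c ∧ v) * χ cs vs)                        ∎
  where
  p = tailParity j cs

pull-scalar : ∀ e s x y → e * (s * x - s * y) ≡ s * (e * (x - y))
pull-scalar = solve 4 (λ e s x y → e :* (s :* x :- s :* y) := s :* (e :* (x :- y))) refl

≡ᵇ0 : ∀ m → (m ≡ᵇ 0) ≡ (m ≤ᵇ 0)
≡ᵇ0 zero = refl
≡ᵇ0 (suc m) = refl

-- A neighbour of `b ∷ v` either keeps `b` and moves `v`, which is the induction hypothesis, or
-- flips `b` alone. The latter contributes twice the character if the first bit of the index is 1,
-- and nothing otherwise.
χ-hypercube : ∀ n (c v : V n) →
  sumV n (λ u → ind (hamming v u ≡ᵇ 1) * (χ c v - χ c u)) ≡ natQ 2 * natQ (weight c) * χ c v
χ-hypercube zero [] [] = refl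
χ-hypercube (suc n) (c ∷ cs) (b ∷ v) = begin
  sumV (suc n) (λ u → ind (hamming (b ∷ v) u ≡ᵇ 1) * (χ (c ∷ cs) (b ∷ v) - χ (c ∷ cs) u))
    ≡⟨ split b ⟩
  sumV n (λ u → ind (hamming v u ≡ᵇ 1) * (s * χ cs v - s * χ cs u)) + sumV n (λ u → ind (hamming v u ≡ᵇ 0) * (s * χ cs v - t * χ cs u))
    ≡⟨ cong₂ _+_
         (trans (sumL-cong (allV n) (λ u → pull-scalar (ind (hamming v u ≡ᵇ 1)) s (χ cs v) (χ cs u))) (sumL-*ˡ (allV n) s _))
         (trans (sumL-cong (allV n) (λ u → cong (λ e → ind e * (s * χ cs v - t * χ cs u))
                  (trans (≡ᵇ0 (hamming v u)) (cong (_≤ᵇ 0) (hamming-sym v u)))))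
                (sumV-eqV n v (λ u → s * χ cs v - t * χ cs u))) ⟩
  s * sumV n (λ u → ind (hamming v u ≡ᵇ 1) * (χ cs v - χ cs u)) + (s * χ cs v - t * χ cs v)
    ≡⟨ cong (λ z → s * z + (s * χ cs v - t * χ cs v)) (χ-hypercube n cs v) ⟩
  s * (natQ 2 * natQ (weight cs) * χ cs v) + (s * χ cs v - t * χ cs v)
    ≡⟨ cases c b ⟩
  natQ 2 * (natQ (bit c) + natQ (weight cs)) * (s * χ cs v)
    ≡⟨ cong (λ z → natQ 2 * z * (s * χ cs v)) (natQ-+ (bit c) (weight cs)) ⟨
  natQ 2 * natQ (weight (c ∷ cs)) * χ (c ∷ cs) (b ∷ v) ∎
  where
  s = sgn (c ∧ b)
  t = sgn (c ∧ not b)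
  split : ∀ b → sumV (suc n) (λ u → ind (hamming (b ∷ v) u ≡ᵇ 1) * (sgn (c ∧ b) * χ cs v - χ (c ∷ cs) u)) ≡
    sumV n (λ u → ind (hamming v u ≡ᵇ 1) * (sgn (c ∧ b) * χ cs v - sgn (c ∧ b) * χ cs u)) +
    sumV n (λ u → ind (hamming v u ≡ᵇ 0) * (sgn (c ∧ b) * χ cs v - sgn (c ∧ not b) * χ cs u))
  -- The half of the cube with first bit `b` is listed first; for `true` this reverses the order of
  -- enumeration.
  split false = sumV-suc n _
  split true = trans (sumV-suc n _) (+-comm (sumV n (λ u → ind (hamming v u ≡ᵇ 0) * (sgn (c ∧ true) * χ cs v - sgn (c ∧ false) * χ cs u))) _)
  cases : ∀ c b → sgn (c ∧ b) * (natQ 2 * natQ (weight cs) * χ cs v) + (sgn (c ∧ b) * χ cs v - sgn (c ∧ not b) * χ cs v)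
    ≡ natQ 2 * (natQ (bit c) + natQ (weight cs)) * (sgn (c ∧ b) * χ cs v)
  cases false b = solve 2 (λ m x → con 1ℚ :* (con (natQ 2) :* m :* x) :+ (con 1ℚ :* x :- con 1ℚ :* x) := con (natQ 2) :* (con 0ℚ :+ m) :* (con 1ℚ :* x)) refl (natQ (weight cs)) (χ cs v)
  cases true false = solve 2 (λ m x → con 1ℚ :* (con (natQ 2) :* m :* x) :+ (con 1ℚ :* x :- :- con 1ℚ :* x) := con (natQ 2) :* (con 1ℚ :+ m) :* (con 1ℚ :* x)) refl (natQ (weight cs)) (χ cs v)
  cases true true = solve 2 (λ m x → :- con 1ℚ :* (con (natQ 2) :* m :* x) :+ (:- con 1ℚ :* x :- con 1ℚ :* x) := con (natQ 2) :* (con 1ℚ :+ m) :* (:- con 1ℚ :* x)) refl (natQ (weight cs)) (χ cs v)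

-- The coordinate edges give twice the weight. The extra edge gives 1 minus the sign of the tail
-- parity, which is 0 or 2.
laplacian-χ : ∀ n j → 2 ≤ n ∸ j → (c v : V n) → laplacian n (suc j) (χ c) v ≡ natQ 2 * natQ (w j c) * χ c v
laplacian-χ n j 2≤m c v = begin
  laplacian n (suc j) (χ c) v
    ≡⟨ sumL-cong (allV n) (λ u → trans (cong (_* (χ c v - χ c u)) (ind-adj n j 2≤m v u)) (*-distribʳ-+ (χ c v - χ c u) (ind (hamming v u ≡ᵇ 1)) _)) ⟩
  sumV n (λ u → ind (hamming v u ≡ᵇ 1) * (χ c v - χ c u) + ind (eqV u (flipFrom (suc j) v)) * (χ c v - χ c u))
    ≡⟨ sumL-+ (allV n) _ _ ⟩
  sumV n (λ u → ind (hamming v u ≡ᵇ 1) * (χ c v - χ c u)) + sumV n (λ u → ind (eqV u (flipFrom (suc j) v)) * (χ c v - χ c u))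
    ≡⟨ cong₂ _+_ (χ-hypercube n c v) (sumV-eqV n (flipFrom (suc j) v) (λ u → χ c v - χ c u)) ⟩
  natQ 2 * natQ (weight c) * χ c v + (χ c v - χ c (flipFrom (suc j) v))
    ≡⟨ cong (λ z → natQ 2 * natQ (weight c) * χ c v + (χ c v - z)) (χ-flipFrom j c v) ⟩
  natQ 2 * natQ (weight c) * χ c v + (χ c v - sgn (tailParity j c) * χ c v)
    ≡⟨ cases (tailParity j c) ⟩
  natQ 2 * (natQ (weight c) + natQ (bit (tailParity j c))) * χ c v
    ≡⟨ cong (λ z → natQ 2 * z * χ c v) (natQ-+ (weight c) (bit (tailParity j c))) ⟨
  natQ 2 * natQ (w j c) * χ c v ∎
  where
  cases : ∀ p → natQ 2 * natQ (weight c) * χ c v + (χ c v - sgn p * χ c v) ≡ natQ 2 * (natQ (weight c) + natQ (bit p)) * χ c v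
  cases false = solve 2 (λ m x → con (natQ 2) :* m :* x :+ (x :- con 1ℚ :* x) := con (natQ 2) :* (m :+ con 0ℚ) :* x) refl (natQ (weight c)) (χ c v)
  cases true = solve 2 (λ m x → con (natQ 2) :* m :* x :+ (x :- :- con 1ℚ :* x) := con (natQ 2) :* (m :+ con 1ℚ) :* x) refl (natQ (weight c)) (χ c v)

laplacian-sumL : ∀ n k {A : Set} (L : List A) (g : A → ℚ) (h : A → V n → ℚ) v →
  laplacian n k (λ u → sumL L (λ c → g c * h c u)) v ≡ sumL L (λ c → g c * laplacian n k (h c) v)
laplacian-sumL n k L g h v = begin
  laplacian n k (λ u → sumL L (λ c → g c * h c u)) v
    ≡⟨ sumL-cong (allV n) (λ u → trans (cong (ind (adj n k v u) *_) (sym (sumL-- L _ _))) (sym (sumL-*ˡ L (ind (adj n k v u)) _))) ⟩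
  sumV n (λ u → sumL L (λ c → ind (adj n k v u) * (g c * h c v - g c * h c u)))
    ≡⟨ sumL-swap (allV n) L _ ⟩
  sumL L (λ c → sumV n (λ u → ind (adj n k v u) * (g c * h c v - g c * h c u)))
    ≡⟨ sumL-cong L (λ c → trans (sumL-cong (allV n) (λ u → pull-scalar (ind (adj n k v u)) (g c) (h c v) (h c u))) (sumL-*ˡ (allV n) (g c) _)) ⟩
  sumL L (λ c → g c * laplacian n k (h c) v) ∎

-- Explicit potentials

2^n≢0 : ∀ n → 2 ℕ.^ n ≢ 0
2^n≢0 n e with ℕₚ.m^n≡0⇒m≡0 2 n e
... | ()

-- Since recip 0 = 0, the trivial character is left out.
coef : ∀ n → ℕ → V n → ℚ
coef n j c = ½ * recip (2 ℕ.^ n) * recip (w j c)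

-- The pseudo-inverse of the Laplacian applied to the dipole at `a`, `b`, written in the eigenbasis
-- of characters.
potential : ∀ n → ℕ → V n → V n → V n → ℚ
potential n j a b v = sumV n (λ c → coef n j c * (χ c a - χ c b) * χ c v)

-- The product of the first two factors is 1 unless `w j c` is 0. In that case the character is
-- trivial, so the difference vanishes and both sides are 0.
recip-w-cancel : ∀ {n} j (c a b : V n) → recip (w j c) * natQ (w j c) * (χ c a - χ c b) ≡ χ c a - χ c b
recip-w-cancel j c a b with w j c in eq
... | zero rewrite χ-zero c (ℕₚ.m+n≡0⇒m≡0 (weight c) eq) a | χ-zero c (ℕₚ.m+n≡0⇒m≡0 (weight c) eq) b = refl
... | suc t = trans (cong (_* (χ c a - χ c b)) (recip-natQ (suc t) (λ ()))) (*-identityˡ (χ c a - χ c b))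

laplacian-potential : ∀ n j → 2 ≤ n ∸ j → (a b v : V n) →
  laplacian n (suc j) (potential n j a b) v ≡ ind (eqV v a) - ind (eqV v b)
laplacian-potential n j 2≤m a b v = begin
  laplacian n (suc j) (potential n j a b) v
    ≡⟨ laplacian-sumL n (suc j) (allV n) (λ c → coef n j c * (χ c a - χ c b)) χ v ⟩
  sumV n (λ c → coef n j c * (χ c a - χ c b) * laplacian n (suc j) (χ c) v)
    -- The eigenvalue cancels the coefficient up to the factor 1/2ⁿ, which orthogonality then
    -- absorbs.
    ≡⟨ sumL-cong (allV n) term ⟩
  sumV n (λ c → R * (χ c v * χ c a - χ c v * χ c b))
    ≡⟨ sumL-*ˡ (allV n) R _ ⟩
  R * sumV n (λ c → χ c v * χ c a - χ c v * χ c b)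
    ≡⟨ cong (R *_) (sumL-- (allV n) _ _) ⟩
  R * (sumV n (λ c → χ c v * χ c a) - sumV n (λ c → χ c v * χ c b))
    ≡⟨ cong (R *_) (cong₂ _-_ (χ-orthogonal n v a) (χ-orthogonal n v b)) ⟩
  R * (N * ind (eqV v a) - N * ind (eqV v b))
    ≡⟨ solve 4 (λ r m x y → r :* (m :* x :- m :* y) := r :* m :* (x :- y)) refl R N (ind (eqV v a)) (ind (eqV v b)) ⟩
  R * N * (ind (eqV v a) - ind (eqV v b))
    ≡⟨ cong (_* (ind (eqV v a) - ind (eqV v b))) (recip-natQ (2 ℕ.^ n) (2^n≢0 n)) ⟩
  1ℚ * (ind (eqV v a) - ind (eqV v b))
    ≡⟨ *-identityˡ (ind (eqV v a) - ind (eqV v b)) ⟩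
  ind (eqV v a) - ind (eqV v b) ∎
  where
  N = natQ (2 ℕ.^ n)
  R = recip (2 ℕ.^ n)
  term : ∀ c → coef n j c * (χ c a - χ c b) * laplacian n (suc j) (χ c) v ≡ R * (χ c v * χ c a - χ c v * χ c b)
  term c = begin
    coef n j c * (χ c a - χ c b) * laplacian n (suc j) (χ c) v
      ≡⟨ cong (coef n j c * (χ c a - χ c b) *_) (laplacian-χ n j 2≤m c v) ⟩
    ½ * R * recip (w j c) * (χ c a - χ c b) * (natQ 2 * natQ (w j c) * χ c v)
      ≡⟨ solve 5 (λ r p q d x → con ½ :* r :* p :* d :* (con (natQ 2) :* q :* x) := r :* (p :* q :* d :* x)) refl
           R (recip (w j c)) (natQ (w j c)) (χ c a - χ c b) (χ c v) ⟩
    R * (recip (w j c) * natQ (w j c) * (χ c a - χ c b) * χ c v)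
      ≡⟨ cong (λ d → R * (d * χ c v)) (recip-w-cancel j c a b) ⟩
    R * ((χ c a - χ c b) * χ c v)
      ≡⟨ solve 4 (λ r x y z → r :* ((x :- y) :* z) := r :* (z :* x :- z :* y)) refl R (χ c a) (χ c b) (χ c v) ⟩
    R * (χ c v * χ c a - χ c v * χ c b) ∎

potential-drop : ∀ n j (a b : V n) →
  potential n j a b a - potential n j a b b ≡ sumV n (λ c → coef n j c * ((χ c a - χ c b) * (χ c a - χ c b)))
potential-drop n j a b = trans (sym (sumL-- (allV n) _ _)) (sumL-cong (allV n) (λ c →
  solve 3 (λ k x y → k :* (x :- y) :* x :- k :* (x :- y) :* y := k :* ((x :- y) :* (x :- y))) refl (coef n j c) (χ c a) (χ c b)))

-- The Kirchhoff index as a sum over characters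

-- Characters take the values ±1, so the square is 2 - 2 χ_c(a) χ_c(b), and for nontrivial c the
-- cross term sums to 0 over b. Ordered pairs thus give 2·4ⁿ, and unordered ones half of that.
χ-pair-sum : ∀ n (c : V n) → weight c ≢ 0 →
  sumL (pairsLT (allV n)) (λ p → (χ c (proj₁ p) - χ c (proj₂ p)) * (χ c (proj₁ p) - χ c (proj₂ p))) ≡ natQ (2 ℕ.^ n) * natQ (2 ℕ.^ n)
χ-pair-sum n c c≢0 = begin
  P                     ≡⟨ solve 1 (λ p → p := con ½ :* (con (natQ 2) :* p)) refl P ⟩
  ½ * (natQ 2 * P)      ≡⟨ cong (½ *_) (sumL-pairsLT (allV n) d² d²-sym d²-diag) ⟨
  ½ * sumV n (λ a → sumV n (d² a))
    ≡⟨ cong (½ *_) (sumL-cong (allV n) row) ⟩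
  ½ * sumV n (λ a → natQ 2 * N)
    ≡⟨ cong (½ *_) (trans (sumL-cong (allV n) (λ _ → *-comm (natQ 2) N)) (trans (sumL-*ˡ (allV n) N _) (cong (N *_) double))) ⟩
  ½ * (N * (natQ 2 * N))
    ≡⟨ solve 1 (λ m → con ½ :* (m :* (con (natQ 2) :* m)) := m :* m) refl N ⟩
  N * N                 ∎
  where
  N = natQ (2 ℕ.^ n)
  d² : V n → V n → ℚ
  d² a b = (χ c a - χ c b) * (χ c a - χ c b)
  P = sumL (pairsLT (allV n)) (λ p → d² (proj₁ p) (proj₂ p))
  d²-sym : ∀ a b → d² a b ≡ d² b a
  d²-sym a b = solve 2 (λ x y → (x :- y) :* (x :- y) := (y :- x) :* (y :- x)) refl (χ c a) (χ c b)
  d²-diag : ∀ a → d² a a ≡ 0ℚ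
  d²-diag a = solve 1 (λ x → (x :- x) :* (x :- x) := con 0ℚ) refl (χ c a)
  double : sumV n (λ _ → natQ 2) ≡ natQ 2 * N
  double = trans (sumL-*ˡ (allV n) (natQ 2) (λ _ → 1ℚ)) (cong (natQ 2 *_) (sumV-one n))
  row : ∀ a → sumV n (d² a) ≡ natQ 2 * N
  row a = begin
    sumV n (d² a)
      ≡⟨ sumL-cong (allV n) (λ b → trans
           (solve 2 (λ x y → (x :- y) :* (x :- y) := x :* x :+ y :* y :- con (natQ 2) :* x :* y) refl (χ c a) (χ c b))
           (cong₂ (λ x y → x + y - natQ 2 * χ c a * χ c b) (χ-square c a) (χ-square c b))) ⟩
    sumV n (λ b → natQ 2 - natQ 2 * χ c a * χ c b)
      ≡⟨ sumL-- (allV n) _ _ ⟩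
    sumV n (λ _ → natQ 2) - sumV n (λ b → natQ 2 * χ c a * χ c b)
      ≡⟨ cong₂ _-_ double (trans (sumL-*ˡ (allV n) (natQ 2 * χ c a) (χ c)) (cong (natQ 2 * χ c a *_) (sumV-χ n c c≢0))) ⟩
    natQ 2 * N - natQ 2 * χ c a * 0ℚ
      ≡⟨ solve 2 (λ m x → con (natQ 2) :* m :- con (natQ 2) :* x :* con 0ℚ := con (natQ 2) :* m) refl N (χ c a) ⟩
    natQ 2 * N ∎

-- Uniqueness of the drop allows any given potential to be replaced by the explicit one. Exchanging
-- the sums then leaves, for each nontrivial c, the coefficient 1/(2ⁿ · 2 w(c)) times 4ⁿ.
Kf-spectral : ∀ n j → 2 ≤ n ∸ j → (r : V n → V n → ℚ) → IsResistance n (suc j) r →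
  Kf n r ≡ ½ * natQ (2 ℕ.^ n) * sumV n (λ c → recip (w j c))
Kf-spectral n j 2≤m r isR = begin
  Kf n r
    ≡⟨ sumL-cong (pairsLT (allV n)) (λ p → r-drop (proj₁ p) (proj₂ p)) ⟩
  sumL (pairsLT (allV n)) (λ p → sumV n (λ c → coef n j c * d² c p))
    ≡⟨ sumL-swap (pairsLT (allV n)) (allV n) _ ⟩
  sumV n (λ c → sumL (pairsLT (allV n)) (λ p → coef n j c * d² c p))
    ≡⟨ sumL-cong (allV n) (λ c → trans (sumL-*ˡ (pairsLT (allV n)) (coef n j c) (d² c)) (term c)) ⟩
  sumV n (λ c → ½ * N * recip (w j c))
    ≡⟨ sumL-*ˡ (allV n) (½ * N) _ ⟩
  ½ * N * sumV n (λ c → recip (w j c)) ∎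
  where
  N = natQ (2 ℕ.^ n)
  R = recip (2 ℕ.^ n)
  d² : V n → V n × V n → ℚ
  d² c p = (χ c (proj₁ p) - χ c (proj₂ p)) * (χ c (proj₁ p) - χ c (proj₂ p))
  r-drop : ∀ a b → r a b ≡ sumV n (λ c → coef n j c * d² c (a , b))
  r-drop a b with isR a b
  ... | x , Lx , r≡ = trans r≡ (trans
    (potential-drop-unique n j x (potential n j a b) a b Lx (laplacian-potential n j 2≤m a b))
    (potential-drop n j a b))
  term : ∀ c → coef n j c * sumL (pairsLT (allV n)) (d² c) ≡ ½ * N * recip (w j c)
  term c with weight c in eq
  -- For the trivial character both sides contain the factor `recip 0`, which is 0.
  ... | zero rewrite tailParity-zero j c eq =
    solve 3 (λ x s m → con ½ :* x :* con 0ℚ :* s := con ½ :* m :* con 0ℚ) refl R (sumL (pairsLT (allV n)) (d² c)) N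
  ... | suc t = begin
    ½ * R * q * sumL (pairsLT (allV n)) (d² c)
      ≡⟨ cong (½ * R * q *_) (χ-pair-sum n c (λ c≡0 → contradiction (trans (sym eq) c≡0) λ ())) ⟩
    ½ * R * q * (N * N)
      ≡⟨ solve 3 (λ x y m → con ½ :* x :* y :* (m :* m) := con ½ :* (x :* m :* m) :* y) refl R q N ⟩
    ½ * (R * N * N) * q
      ≡⟨ cong (λ z → ½ * (z * N) * q) (recip-natQ (2 ℕ.^ n) (2^n≢0 n)) ⟩
    ½ * (1ℚ * N) * q
      ≡⟨ cong (λ z → ½ * z * q) (*-identityˡ N) ⟩
    ½ * N * q ∎
    where
    q = recip (suc t ℕ.+ bit (tailParity j c))

-- Counting characters by eigenvalue

sumTo-cong : ∀ N {f g : ℕ → ℚ} → (∀ s → f s ≡ g s) → sumTo N f ≡ sumTo N g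
sumTo-cong zero e = e 0
sumTo-cong (suc N) e = cong₂ _+_ (sumTo-cong N e) (e (suc N))

sumTo-zero : ∀ N → sumTo N (λ _ → 0ℚ) ≡ 0ℚ
sumTo-zero zero = refl
sumTo-zero (suc N) = trans (+-identityʳ _) (sumTo-zero N)

sumTo-+ : ∀ N (f g : ℕ → ℚ) → sumTo N (λ s → f s + g s) ≡ sumTo N f + sumTo N g
sumTo-+ zero f g = refl
sumTo-+ (suc N) f g = trans (cong (_+ (f (suc N) + g (suc N))) (sumTo-+ N f g))
  (solve 4 (λ s t x y → s :+ t :+ (x :+ y) := s :+ x :+ (t :+ y)) refl (sumTo N f) (sumTo N g) (f (suc N)) (g (suc N)))

sumTo-*ˡ : ∀ N q (f : ℕ → ℚ) → sumTo N (λ s → q * f s) ≡ q * sumTo N f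
sumTo-*ˡ zero q f = refl
sumTo-*ˡ (suc N) q f = trans (cong (_+ q * f (suc N)) (sumTo-*ˡ N q f)) (sym (*-distribˡ-+ q (sumTo N f) (f (suc N))))

sumTo-swap : ∀ M N (f : ℕ → ℕ → ℚ) → sumTo M (λ s → sumTo N (f s)) ≡ sumTo N (λ l → sumTo M (λ s → f s l))
sumTo-swap zero N f = refl
sumTo-swap (suc M) N f = trans (cong (_+ sumTo N (f (suc M))) (sumTo-swap M N f))
  (sym (sumTo-+ N (λ l → sumTo M (λ s → f s l)) (f (suc M))))

sumTo-head : ∀ N (f : ℕ → ℚ) → sumTo (suc N) f ≡ f 0 + sumTo N (f ∘ suc)
sumTo-head zero f = refl
sumTo-head (suc N) f = trans (cong (_+ f (suc (suc N))) (sumTo-head N f)) (+-assoc (f 0) _ _)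

-- This is ∑_i C(M,i) H(i) in the form of Pascal's recursion, which follows the splitting of the
-- cube on its first bit.
binomialSum : ℕ → (ℕ → ℚ) → ℚ
binomialSum zero H = H 0
binomialSum (suc M) H = binomialSum M H + binomialSum M (H ∘ suc)

binomialSum-cong : ∀ M {H K : ℕ → ℚ} → (∀ s → H s ≡ K s) → binomialSum M H ≡ binomialSum M K
binomialSum-cong zero e = e 0
binomialSum-cong (suc M) e = cong₂ _+_ (binomialSum-cong M e) (binomialSum-cong M (e ∘ suc))

binomialSum-sumTo : ∀ M N (q : ℕ → ℚ) (H : ℕ → ℕ → ℚ) →
  binomialSum M (λ i → sumTo N (λ l → q l * H l i)) ≡ sumTo N (λ l → q l * binomialSum M (H l))
binomialSum-sumTo zero N q H = refl
binomialSum-sumTo (suc M) N q H = begin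
  binomialSum M (λ i → sumTo N (λ l → q l * H l i)) + binomialSum M (λ i → sumTo N (λ l → q l * H l (suc i)))
    ≡⟨ cong₂ _+_ (binomialSum-sumTo M N q H) (binomialSum-sumTo M N q (λ l → H l ∘ suc)) ⟩
  sumTo N (λ l → q l * binomialSum M (H l)) + sumTo N (λ l → q l * binomialSum M (H l ∘ suc))
    ≡⟨ sumTo-+ N _ _ ⟨
  sumTo N (λ l → q l * binomialSum M (H l) + q l * binomialSum M (H l ∘ suc))
    ≡⟨ sumTo-cong N (λ l → sym (*-distribˡ-+ (q l) (binomialSum M (H l)) (binomialSum M (H l ∘ suc)))) ⟩
  sumTo N (λ l → q l * binomialSum (suc M) (H l)) ∎

nC0≡1 : ∀ M → M C 0 ≡ 1
nC0≡1 M = trans (nCk≡nC[n∸k] {0} {M} z≤n) (nCn≡1 M)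

-- The bound `N` is left free because Pascal's rule splits the sum for M+1 into sums for M with
-- different bounds; terms beyond M vanish.
binomialSum-C : ∀ M N → M ≤ N → (H : ℕ → ℚ) → sumTo N (λ s → natQ (M C s) * H s) ≡ binomialSum M H
binomialSum-C zero zero _ H = *-identityˡ (H 0)
binomialSum-C zero (suc N) _ H = trans (cong₂ _+_ (binomialSum-C zero N z≤n H) (*-zeroˡ (H (suc N)))) (+-identityʳ (H 0))
binomialSum-C (suc M) (suc N) (s≤s M≤N) H = begin
  sumTo (suc N) (λ s → natQ (suc M C s) * H s)
    ≡⟨ sumTo-head N _ ⟩
  natQ (suc M C 0) * H 0 + sumTo N (λ s → natQ (suc M C suc s) * H (suc s))
    ≡⟨ cong₂ (λ x y → natQ x * H 0 + y) (trans (nC0≡1 (suc M)) (sym (nC0≡1 M))) (trans (sumTo-cong N pascal) (sumTo-+ N _ _)) ⟩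
  natQ (M C 0) * H 0 + (sumTo N (λ s → natQ (M C suc s) * H (suc s)) + sumTo N (λ s → natQ (M C s) * H (suc s)))
    ≡⟨ +-assoc (natQ (M C 0) * H 0) _ _ ⟨
  natQ (M C 0) * H 0 + sumTo N (λ s → natQ (M C suc s) * H (suc s)) + sumTo N (λ s → natQ (M C s) * H (suc s))
    ≡⟨ cong (_+ sumTo N (λ s → natQ (M C s) * H (suc s))) (sumTo-head N _) ⟨
  sumTo (suc N) (λ s → natQ (M C s) * H s) + sumTo N (λ s → natQ (M C s) * H (suc s))
    ≡⟨ cong₂ _+_ (binomialSum-C M (suc N) (ℕₚ.m≤n⇒m≤1+n M≤N) H) (binomialSum-C M N M≤N (H ∘ suc)) ⟩
  binomialSum (suc M) H ∎
  where
  pascal : ∀ s → natQ (suc M C suc s) * H (suc s) ≡ natQ (M C suc s) * H (suc s) + natQ (M C s) * H (suc s)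
  pascal s = begin
    natQ (suc M C suc s) * H (suc s)
      ≡⟨ cong (λ x → natQ x * H (suc s)) (trans (sym (nCk+nC[k+1]≡[n+1]C[k+1] M s)) (ℕₚ.+-comm (M C s) (M C suc s))) ⟩
    natQ (M C suc s ℕ.+ M C s) * H (suc s)
      ≡⟨ cong (_* H (suc s)) (natQ-+ (M C suc s) (M C s)) ⟩
    (natQ (M C suc s) + natQ (M C s)) * H (suc s)
      ≡⟨ *-distribʳ-+ (H (suc s)) (natQ (M C suc s)) (natQ (M C s)) ⟩
    natQ (M C suc s) * H (suc s) + natQ (M C s) * H (suc s) ∎

-- Keeps `F` at odd arguments for `true` and at even ones for `false`. Recursion by shifting makes
-- composition with `suc` compute to the opposite parity, as the recursion of `binomialSum` demands.
restrictParity : Bool → (ℕ → ℚ) → ℕ → ℚ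
restrictParity β F zero = if β then 0ℚ else F 0
restrictParity β F (suc s) = restrictParity (not β) (F ∘ suc) s

restrictParity-even : ∀ F l → restrictParity false F (2 ℕ.* l) ≡ F (2 ℕ.* l)
restrictParity-even F zero = refl
restrictParity-even F (suc l) = trans (cong (restrictParity false F) (ℕₚ.*-suc 2 l))
  (trans (restrictParity-even (F ∘ suc ∘ suc) l) (cong F (sym (ℕₚ.*-suc 2 l))))

restrictParity-odd : ∀ F l → restrictParity true F (2 ℕ.* l) ≡ 0ℚ
restrictParity-odd F zero = refl
restrictParity-odd F (suc l) = trans (cong (restrictParity true F) (ℕₚ.*-suc 2 l)) (restrictParity-odd (F ∘ suc ∘ suc) l)

-- The lower indices 2j of the formula arise here: of two consecutive indices the odd one
-- contributes 0.
sumTo-restrictParity : ∀ n (q F : ℕ → ℚ) →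
  sumTo (2 ℕ.* n) (λ s → q s * restrictParity false F s) ≡ sumTo n (λ l → q (2 ℕ.* l) * F (2 ℕ.* l))
sumTo-restrictParity zero q F = refl
sumTo-restrictParity (suc n) q F = begin
  sumTo (2 ℕ.* suc n) h
    ≡⟨ cong (λ N → sumTo N h) (ℕₚ.*-suc 2 n) ⟩
  sumTo (2 ℕ.* n) h + q (suc (2 ℕ.* n)) * restrictParity true (F ∘ suc) (2 ℕ.* n) + h (2 ℕ.+ 2 ℕ.* n)
    ≡⟨ cong₂ (λ x y → sumTo (2 ℕ.* n) h + q (suc (2 ℕ.* n)) * x + y)
         (restrictParity-odd (F ∘ suc) n)
         (trans (cong h (sym (ℕₚ.*-suc 2 n))) (cong (q (2 ℕ.* suc n) *_) (restrictParity-even F (suc n)))) ⟩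
  sumTo (2 ℕ.* n) h + q (suc (2 ℕ.* n)) * 0ℚ + q (2 ℕ.* suc n) * F (2 ℕ.* suc n)
    ≡⟨ cong₂ (λ x y → x + y + q (2 ℕ.* suc n) * F (2 ℕ.* suc n)) (sumTo-restrictParity n q F) (*-zeroʳ (q (suc (2 ℕ.* n)))) ⟩
  sumTo n (λ l → q (2 ℕ.* l) * F (2 ℕ.* l)) + 0ℚ + q (2 ℕ.* suc n) * F (2 ℕ.* suc n)
    ≡⟨ cong (_+ q (2 ℕ.* suc n) * F (2 ℕ.* suc n)) (+-identityʳ (sumTo n (λ l → q (2 ℕ.* l) * F (2 ℕ.* l)))) ⟩
  sumTo (suc n) (λ l → q (2 ℕ.* l) * F (2 ℕ.* l)) ∎
  where
  h : ℕ → ℚ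
  h s = q s * restrictParity false F s

-- Appending a parity bit to c ∈ ℤ₂ᵐ gives each vector of ℤ₂ᵐ⁺¹ of parity β exactly once.
sumV-parity : ∀ m β (F : ℕ → ℚ) →
  sumV m (λ c → F (weight c ℕ.+ bit (tailParity 0 c xor β))) ≡ binomialSum (suc m) (restrictParity β F)
sumV-parity zero false F = refl
sumV-parity zero true F = trans (+-identityʳ (F 1)) (sym (+-identityˡ (F 1)))
sumV-parity (suc m) β F = begin
  sumV (suc m) (λ c → F (weight c ℕ.+ bit (tailParity 0 c xor β)))
    ≡⟨ sumV-suc m _ ⟩
  sumV m (λ c → F (weight c ℕ.+ bit (tailParity 0 c xor β))) + sumV m (λ c → F (suc (weight c ℕ.+ bit (not (tailParity 0 c) xor β))))
    -- A leading 1 flips the parity bit, so its half is the case `not β` with weights shifted by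
    -- one.
    ≡⟨ cong₂ _+_ (sumV-parity m β F) (trans
         (sumL-cong (allV m) (λ c → cong (λ b → F (suc (weight c ℕ.+ bit b))) (not-xor (tailParity 0 c) β)))
         (sumV-parity m (not β) (F ∘ suc))) ⟩
  binomialSum (suc (suc m)) (restrictParity β F) ∎
  where
  not-xor : ∀ a b → not a xor b ≡ a xor not b
  not-xor false b = refl
  not-xor true false = refl
  not-xor true true = refl

-- The first `j` coordinates affect `w` only through the weight, so each is one Pascal step; the
-- other `m`, with their parity bit, form an even vector of length m+1.
sumV-w : ∀ j m (F : ℕ → ℚ) →
  sumV (j ℕ.+ m) (λ c → F (w j c)) ≡ binomialSum j (λ i → binomialSum (suc m) (restrictParity false (λ s → F (i ℕ.+ s))))
sumV-w zero m F = trans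
  (sumL-cong (allV m) (λ c → cong (λ b → F (weight c ℕ.+ bit b)) (sym (xor-identityʳ (tailParity 0 c)))))
  (sumV-parity m false F)
  where open import Data.Bool.Properties using (xor-identityʳ)
sumV-w (suc j) m F = trans (sumV-suc (j ℕ.+ m) _) (cong₂ _+_ (sumV-w j m F) (sumV-w j m (F ∘ suc)))

binomDiff-suc : ∀ j s c → binomDiff j (suc s) (suc c) ≡ binomDiff j s c
binomDiff-suc j s zero = refl
binomDiff-suc j s (suc c) = refl

-- The terms with s < c vanish by the convention on binomials with negative lower index; the rest is
-- reindexed by s = c+i.
sumTo-binomDiff : ∀ j c N (F : ℕ → ℚ) →
  sumTo (c ℕ.+ N) (λ s → natQ (binomDiff j s c) * F s) ≡ sumTo N (λ i → natQ (j C i) * F (c ℕ.+ i))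
sumTo-binomDiff j zero N F = refl
sumTo-binomDiff j (suc c) N F = begin
  sumTo (suc (c ℕ.+ N)) (λ s → natQ (binomDiff j s (suc c)) * F s)
    ≡⟨ sumTo-head (c ℕ.+ N) _ ⟩
  0ℚ * F 0 + sumTo (c ℕ.+ N) (λ s → natQ (binomDiff j (suc s) (suc c)) * F (suc s))
    ≡⟨ cong₂ _+_ (*-zeroˡ (F 0)) (sumTo-cong (c ℕ.+ N) (λ s → cong (λ x → natQ x * F (suc s)) (binomDiff-suc j s c))) ⟩
  0ℚ + sumTo (c ℕ.+ N) (λ s → natQ (binomDiff j s c) * F (suc s))
    ≡⟨ +-identityˡ _ ⟩
  sumTo (c ℕ.+ N) (λ s → natQ (binomDiff j s c) * F (suc s))
    ≡⟨ sumTo-binomDiff j c N (F ∘ suc) ⟩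
  sumTo N (λ i → natQ (j C i) * F (suc c ℕ.+ i)) ∎

-- Passes from the weight i on the first coordinates to the total s = i+c as summation index, within
-- any range that reaches j+c.
binomialSum-shift : ∀ j c N → j ℕ.+ c ≤ N → (F : ℕ → ℚ) →
  binomialSum j (λ i → F (i ℕ.+ c)) ≡ sumTo N (λ s → natQ (binomDiff j s c) * F s)
binomialSum-shift j c N j+c≤N F = begin
  binomialSum j (λ i → F (i ℕ.+ c))
    ≡⟨ binomialSum-cong j (λ i → cong F (ℕₚ.+-comm i c)) ⟩
  binomialSum j (λ i → F (c ℕ.+ i))
    ≡⟨ binomialSum-C j (N ∸ c) (ℕₚ.m+n≤o⇒m≤o∸n j j+c≤N) _ ⟨
  sumTo (N ∸ c) (λ i → natQ (j C i) * F (c ℕ.+ i))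
    ≡⟨ sumTo-binomDiff j c (N ∸ c) F ⟨
  sumTo (c ℕ.+ (N ∸ c)) (λ s → natQ (binomDiff j s c) * F s)
    ≡⟨ cong (λ z → sumTo z (λ s → natQ (binomDiff j s c) * F s)) (ℕₚ.m+[n∸m]≡n (ℕₚ.m+n≤o⇒n≤o j j+c≤N)) ⟩
  sumTo N (λ s → natQ (binomDiff j s c) * F s) ∎

natQ-C-zero : ∀ {M c} → M < c → ∀ x → natQ (M C c) * x ≡ 0ℚ
natQ-C-zero M<c x = trans (cong (λ z → natQ z * x) (k>n⇒nCk≡0 M<c)) (*-zeroˡ x)

-- The term of `formula` for M = n-k+2 and j = k-1, since `recip (suc t)` computes to the fraction
-- used there.
summand : (M j t l : ℕ) → ℚ
summand M j t l = recip (suc t) * natQ (M C (2 ℕ.* l)) * natQ (binomDiff j (suc t) (2 ℕ.* l))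

sumV-recip-w : ∀ j m → 1 ≤ m →
  sumV (j ℕ.+ m) (λ c → recip (w j c)) ≡ sumTo (j ℕ.+ m) (λ t → sumTo (j ℕ.+ m) (summand (suc m) j t))
sumV-recip-w j m 1≤m = begin
  sumV n (λ c → recip (w j c))
    ≡⟨ sumV-w j m recip ⟩
  binomialSum j (λ i → binomialSum (suc m) (restrictParity false (λ s → recip (i ℕ.+ s))))
    -- The bound 2n makes the even indices 2l run over l ≤ n, the range of the inner sum in the
    -- formula.
    ≡⟨ binomialSum-cong j (λ i → trans (sym (binomialSum-C (suc m) (2 ℕ.* n) 1+m≤2n _)) (sumTo-restrictParity n (λ s → natQ (suc m C s)) _)) ⟩
  binomialSum j (λ i → sumTo n (λ l → q l * recip (i ℕ.+ 2 ℕ.* l)))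
    ≡⟨ binomialSum-sumTo j n q (λ l i → recip (i ℕ.+ 2 ℕ.* l)) ⟩
  sumTo n (λ l → q l * binomialSum j (λ i → recip (i ℕ.+ 2 ℕ.* l)))
    ≡⟨ sumTo-cong n term ⟩
  sumTo n (λ l → q l * sumTo (suc n) (λ s → natQ (binomDiff j s (2 ℕ.* l)) * recip s))
    -- The term s = 0 vanishes because `recip 0` is 0; the others are renumbered by s = t+1.
    ≡⟨ sumTo-cong n (λ l → cong (q l *_) (dropHead l)) ⟩
  sumTo n (λ l → q l * sumTo n (tail l))
    ≡⟨ sumTo-cong n (λ l → trans (sym (sumTo-*ˡ n (q l) _)) (sumTo-cong n (λ t →
         solve 3 (λ x y z → x :* (y :* z) := z :* x :* y) refl (q l) (natQ (binomDiff j (suc t) (2 ℕ.* l))) (recip (suc t))))) ⟩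
  sumTo n (λ l → sumTo n (λ t → summand (suc m) j t l))
    ≡⟨ sumTo-swap n n (λ l t → summand (suc m) j t l) ⟩
  sumTo n (λ t → sumTo n (summand (suc m) j t)) ∎
  where
  n = j ℕ.+ m
  q : ℕ → ℚ
  q l = natQ (suc m C (2 ℕ.* l))
  tail : ℕ → ℕ → ℚ
  tail l t = natQ (binomDiff j (suc t) (2 ℕ.* l)) * recip (suc t)
  1+m≤2n : suc m ≤ 2 ℕ.* n
  1+m≤2n = ℕₚ.+-mono-≤ (ℕₚ.≤-trans 1≤m (ℕₚ.m≤n+m m j)) (ℕₚ.≤-trans (ℕₚ.m≤n+m m j) (ℕₚ.m≤m+n n 0))
  term : ∀ l → q l * binomialSum j (λ i → recip (i ℕ.+ 2 ℕ.* l)) ≡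
    q l * sumTo (suc n) (λ s → natQ (binomDiff j s (2 ℕ.* l)) * recip s)
  -- For 2l ≤ m+1 the largest total j+2l is at most n+1; otherwise C(m+1, 2l) annihilates both
  -- sides.
  term l with 2 ℕ.* l ℕ.≤? suc m
  ... | yes 2l≤M = cong (q l *_) (binomialSum-shift j (2 ℕ.* l) (suc n)
    (ℕₚ.≤-trans (ℕₚ.+-monoʳ-≤ j 2l≤M) (ℕₚ.≤-reflexive (ℕₚ.+-suc j m))) recip)
  ... | no 2l≰M = trans (natQ-C-zero (ℕₚ.≰⇒> 2l≰M) _) (sym (natQ-C-zero (ℕₚ.≰⇒> 2l≰M) _))
  dropHead : ∀ l → sumTo (suc n) (λ s → natQ (binomDiff j s (2 ℕ.* l)) * recip s) ≡
    sumTo n (tail l)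
  dropHead l = trans (sumTo-head n _)
    (trans (cong (_+ sumTo n (tail l)) (*-zeroʳ (natQ (binomDiff j 0 (2 ℕ.* l))))) (+-identityˡ (sumTo n (tail l))))

-- Comparison with the stated formula

half-2^ : ∀ n → 1 ≤ n → ½ * natQ (2 ℕ.^ n) ≡ natQ (2 ℕ.^ (n ∸ 1))
half-2^ (suc n) _ = trans (cong (½ *_) (natQ-* 2 (2 ℕ.^ n)))
  (solve 1 (λ x → con ½ :* (con (natQ 2) :* x) := x) refl (natQ (2 ℕ.^ n)))

-- With n = j+m and k = j+1 this identifies n-k+2 with the length of the even vectors; `1 ≤ m` keeps
-- the subtraction from truncating.
[j+m]∸[1+j]+2 : ∀ j m → 1 ≤ m → (j ℕ.+ m) ∸ suc j ℕ.+ 2 ≡ suc m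
[j+m]∸[1+j]+2 zero (suc m) _ = ℕₚ.+-comm m 2
[j+m]∸[1+j]+2 (suc j) m 1≤m = [j+m]∸[1+j]+2 j m 1≤m

formula-spectral : ∀ j m → 1 ≤ m →
  ½ * natQ (2 ℕ.^ (j ℕ.+ m)) * sumV (j ℕ.+ m) (λ c → recip (w j c)) ≡ formula (j ℕ.+ m) (j ℕ.+ m) (suc j)
formula-spectral j m 1≤m = trans
  (cong₂ _*_ (half-2^ (j ℕ.+ m) (ℕₚ.≤-trans 1≤m (ℕₚ.m≤n+m m j))) (sumV-recip-w j m 1≤m))
  (cong (λ M → natQ (2 ℕ.^ (j ℕ.+ m ∸ 1)) * sumTo (j ℕ.+ m) (λ t → sumTo (j ℕ.+ m) (summand M j t))) (sym ([j+m]∸[1+j]+2 j m 1≤m)))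

binomDiff-zero : ∀ j s c → j ℕ.+ c < s → binomDiff j s c ≡ 0
binomDiff-zero j s c j+c<s with c ≤ᵇ s
... | false = refl
... | true = k>n⇒nCk≡0 (ℕₚ.m+n≤o⇒m≤o∸n (suc j) j+c<s)

-- For odd n - k the number n - k + 2 is odd, so 2l ≤ n - k + 2 forces n + 1 - 2l > k - 1.
last-term-zero : ∀ j m → ¬ ((j ℕ.+ m) % 2 ≡ suc j % 2) → ∀ l → summand (suc m) j (j ℕ.+ m) l ≡ 0ℚ
last-term-zero j m odd l with ℕₚ.<-cmp (2 ℕ.* l) (suc m)
... | tri< 2l<M _ _ = trans
  (cong (λ x → recip (suc (j ℕ.+ m)) * natQ (suc m C (2 ℕ.* l)) * natQ x)
    (binomDiff-zero j (suc (j ℕ.+ m)) (2 ℕ.* l) (ℕₚ.<-≤-trans (ℕₚ.+-monoʳ-< j 2l<M) (ℕₚ.≤-reflexive (ℕₚ.+-suc j m)))))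
  (*-zeroʳ (recip (suc (j ℕ.+ m)) * natQ (suc m C (2 ℕ.* l))))
... | tri> _ _ M<2l = trans
  (cong (λ x → recip (suc (j ℕ.+ m)) * natQ x * natQ (binomDiff j (suc (j ℕ.+ m)) (2 ℕ.* l))) (k>n⇒nCk≡0 M<2l))
  (solve 2 (λ x y → x :* con 0ℚ :* y := con 0ℚ) refl (recip (suc (j ℕ.+ m))) (natQ (binomDiff j (suc (j ℕ.+ m)) (2 ℕ.* l))))
-- If 2l = m+1, then n+2 = k+2l, so n and k have the same parity.
... | tri≈ _ 2l≡M _ = contradiction same-parity odd
  where
  same-parity : (j ℕ.+ m) % 2 ≡ suc j % 2
  same-parity = begin
    (j ℕ.+ m) % 2                    ≡⟨ [m+kn]%n≡m%n (j ℕ.+ m) 1 2 ⟨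
    (j ℕ.+ m ℕ.+ 2) % 2              ≡⟨ cong (_% 2) (ℕₚ.+-comm (j ℕ.+ m) 2) ⟩
    (2 ℕ.+ (j ℕ.+ m)) % 2            ≡⟨ cong (λ z → suc z % 2) (sym (ℕₚ.+-suc j m)) ⟩
    (suc j ℕ.+ suc m) % 2            ≡⟨ cong (λ z → (suc j ℕ.+ z) % 2) (trans (sym 2l≡M) (ℕₚ.*-comm 2 l)) ⟩
    (suc j ℕ.+ l ℕ.* 2) % 2          ≡⟨ [m+kn]%n≡m%n (suc j) l 2 ⟩
    suc j % 2                        ∎

formula-pred : ∀ j m → 1 ≤ m → ¬ ((j ℕ.+ m) % 2 ≡ suc j % 2) →
  formula (j ℕ.+ m) (j ℕ.+ m) (suc j) ≡ formula (j ℕ.+ m ∸ 1) (j ℕ.+ m) (suc j)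
formula-pred j m 1≤m odd = cong (natQ (2 ℕ.^ (n ∸ 1)) *_) (dropLast n _
    (trans (sumTo-cong n (λ l → trans (cong (λ M → summand M j n l) ([j+m]∸[1+j]+2 j m 1≤m)) (last-term-zero j m odd l))) (sumTo-zero n))
    (ℕₚ.≤-trans 1≤m (ℕₚ.m≤n+m m j)))
  where
  n = j ℕ.+ m
  dropLast : ∀ N (f : ℕ → ℚ) → f N ≡ 0ℚ → 1 ≤ N → sumTo N f ≡ sumTo (N ∸ 1) f
  dropLast (suc N) f fN≡0 _ = trans (cong (sumTo N f +_) fN≡0) (+-identityʳ _)

theorem4 : (n k : ℕ) → 2 ≤ n → 1 ≤ k → k ≤ n ∸ 1 →
    Σ (V n → V n → ℚ) (IsResistance n k) ×
    ((r : V n → V n → ℚ) → IsResistance n k r →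
    (n % 2 ≡ k % 2 → Kf n r ≡ formula n n k) ×
    (¬ (n % 2 ≡ k % 2) → Kf n r ≡ formula (n ∸ 1) n k))
theorem4 (suc n) (suc j) 2≤n _ k≤n =
  ((λ a b → potential (suc n) j a b a - potential (suc n) j a b b) ,
    λ a b → potential (suc n) j a b , laplacian-potential (suc n) j 2≤m a b , refl) ,
  λ r isR →
    (λ _ → Kf-formula r isR) ,
    λ odd → trans (Kf-formula r isR) (subst (λ z → ¬ (z % 2 ≡ suc j % 2) → formula z z (suc j) ≡ formula (z ∸ 1) z (suc j)) j+m≡n
      (formula-pred j m 1≤m) odd)
  where
  -- The number n-k+1 of coordinates flipped by the extra edge, at least 2 because k ≤ n-1.
  m = suc n ∸ j
  2≤m : 2 ≤ m
  2≤m = ℕₚ.m+n≤o⇒m≤o∸n 2 (s≤s k≤n)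
  1≤m : 1 ≤ m
  1≤m = ℕₚ.≤-trans (s≤s z≤n) 2≤m
  j+m≡n : j ℕ.+ m ≡ suc n
  j+m≡n = ℕₚ.m+[n∸m]≡n (ℕₚ.≤-trans (ℕₚ.n≤1+n j) (ℕₚ.m≤n⇒m≤1+n k≤n))
  Kf-formula : ∀ r → IsResistance (suc n) (suc j) r → Kf (suc n) r ≡ formula (suc n) (suc n) (suc j)
  -- The counting is done for cubes of dimension j+m, where the split at coordinate k is visible in
  -- the type; the result is transported along `j+m≡n`.
  Kf-formula r isR = trans (Kf-spectral (suc n) j 2≤m r isR)
    (subst (λ z → ½ * natQ (2 ℕ.^ z) * sumV z (λ c → recip (w j c)) ≡ formula z z (suc j)) j+m≡n (formula-spectral j m 1≤m))
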